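{- Let $G=(V,E)$ be a connected claw-free graph with clique number $\omega(G)=\omega\ge 5$. Then one of the following is true: (i) $G$ is the line graph $L(F)$ of a graph $F$ of maximum degree $\omega$; or (ii) there exists $v\in V$ with $\deg_{G^2}(v)\le 2\omega(\omega-1)-4$ such that $\deg_{G^2}(x)\le 2\omega(\omega-1)-3$ for all $x\in N_G(v)$.
   Context: A graph is claw-free if it has no induced $K_{1,3}$. The square $G^2$ of $G$ is the graph on $V$ in which two distinct vertices are adjacent iff they are at distance at most $2$ in $G$; $\deg_{G^2}(v)$ is the degree of $v$ in $G^2$; $N_G(v)$ is the open neighbourhood of $v$ in $G$. -}

module Defs where

open import Data.Bool using (Bool; true; false; T; T?; _∧_; _∨_; not)
open import Data.Nat using (ℕ; _≤_; _<_)
open import Data.Fin using (Fin; _≟_)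
import Data.Fin as F
open import Data.Fin.Subset using (Subset; _∈_; ∣_∣)
open import Data.Vec using (tabulate)
open import Data.Product using (Σ; Σ-syntax; ∃; ∃-syntax; _×_; _,_)
open import Data.Sum using (_⊎_)
open import Data.Empty using (⊥)
open import Relation.Nullary using (¬_)
open import Relation.Nullary.Decidable using (⌊_⌋)
open import Relation.Binary.PropositionalEquality using (_≡_; _≢_)
open import Data.Fin.Properties using (any?)

record Graph (n : ℕ) : Set where
  field
    adj     : Fin n → Fin n → Bool
    adj-sym : ∀ u v → adj u v ≡ adj v u
    adj-irr : ∀ v → adj v v ≡ false
open Graph public

Adj : ∀ {n} → Graph n → Fin n → Fin n → Set
Adj G u v = T (adj G u v)

nbhd : ∀ {n} → Graph n → Fin n → Subset n
nbhd G v = tabulate (adj G v)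

degree : ∀ {n} → Graph n → Fin n → ℕ
degree G v = ∣ nbhd G v ∣

data Reach {n} (G : Graph n) : Fin n → Fin n → Set where
  here : ∀ {u} → Reach G u u
  step : ∀ {u v w} → Adj G u v → Reach G v w → Reach G u w

Connected : ∀ {n} → Graph n → Set
Connected G = ∀ u v → Reach G u v

ClawFree : ∀ {n} → Graph n → Set
ClawFree G = ∀ c a b d → Adj G c a → Adj G c b → Adj G c d →
  a ≢ b → a ≢ d → b ≢ d →
  ¬ Adj G a b → ¬ Adj G a d → ¬ Adj G b d → ⊥

IsClique : ∀ {n} → Graph n → Subset n → Set
IsClique G S = ∀ u v → u ∈ S → v ∈ S → u ≢ v → Adj G u v

CliqueNumber : ∀ {n} → Graph n → ℕ → Set
CliqueNumber G ω = (Σ[ S ∈ _ ] (IsClique G S × ∣ S ∣ ≡ ω))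
                 × (∀ S → IsClique G S → ∣ S ∣ ≤ ω)

MaxDegree : ∀ {m} → Graph m → ℕ → Set
MaxDegree F Δ = (∀ x → degree F x ≤ Δ) × (∃[ x ] degree F x ≡ Δ)

sqAdj : ∀ {n} → Graph n → Fin n → Fin n → Bool
sqAdj G u v = not ⌊ u ≟ v ⌋ ∧
  (adj G u v ∨ ⌊ any? (λ w → T? (adj G u w ∧ adj G w v)) ⌋)

degSq : ∀ {n} → Graph n → Fin n → ℕ
degSq G v = ∣ tabulate (sqAdj G v) ∣

Edge : ∀ {m} → Graph m → Set
Edge {m} F = Σ[ a ∈ Fin m ] Σ[ b ∈ Fin m ] (a F.< b × Adj F a b)

LAdj : ∀ {m} (F : Graph m) → Edge F → Edge F → Set
LAdj F e@(a , b , _) e'@(a' , b' , _) =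
  e ≢ e' × (a ≡ a' ⊎ a ≡ b' ⊎ b ≡ a' ⊎ b ≡ b')

IsLineGraphOf : ∀ {n m} → Graph n → Graph m → Set
IsLineGraphOf {n} G F =
  Σ[ φ ∈ (Fin n → Edge F) ]
    ((∀ u v → φ u ≡ φ v → u ≡ v)
    × (∀ e → ∃[ u ] φ u ≡ e)
    × (∀ u v → (Adj G u v → LAdj F (φ u) (φ v)) × (LAdj F (φ u) (φ v) → Adj G u v)))

{-# OPTIONS --safe #-}
module Submission where

open import Defs
open import Data.Bool using (Bool; true; false; if_then_else_; not; T; T?)
open import Data.Bool.Properties using (T-≡; T-∧; T-∨; T-irrelevant; not-involutive)
open import Data.Empty using (⊥; ⊥-elim)
open import Data.Fin using (Fin; zero; suc; _≟_; combine; funToFin; finToFun)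
import Data.Fin as F
import Data.Fin.Properties as F
open import Data.Fin.Properties using (any?; all?; finToFun-funToFin)
open import Data.Fin.Subset using (Subset; ∣_∣) renaming (_∈_ to _∈ₛ_)
open import Data.List using (List; []; _∷_; allFin)
open import Data.List.Membership.Propositional using (_∈_)
open import Data.List.Membership.Propositional.Properties using (∈-allFin)
open import Data.List.Relation.Unary.Any using (here; there)
open import Data.Nat using (ℕ; zero; suc; _+_; _*_; _∸_; _^_; _≤_; _<_; z≤n; s≤s; s≤s⁻¹; _≤?_; NonZero; >-nonZero)
open import Data.Nat.Properties hiding (_≟_)
open import Algebra.Properties.Semiring.Sum +-*-semiring using (sum; ∑-comm; ∑-distrib-+; *-distribˡ-sum; *-distribʳ-sum; sum-cong-≗; sum-replicate-zero)
open import Data.Nat.Tactic.RingSolver using (solve-∀)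
open import Data.Product using (Σ-syntax; ∃-syntax; ∃₂; _×_; _,_; proj₁; proj₂)
open import Data.Sum using (_⊎_; inj₁; inj₂; [_,_]′)
open import Data.Vec using (tabulate; _∷_)
open import Data.Vec.Properties using (lookup∘tabulate; []=⇒lookup)
open import Function using (_∘_; id)
open import Function.Bundles using (Equivalence; mk⇔)
open import Relation.Binary.Definitions using (tri<; tri≈; tri>)
open import Relation.Binary.PropositionalEquality
open import Relation.Nullary using (¬_; Dec; yes; no; does; contradiction)
open import Relation.Nullary.Decidable using (¬?; _×-dec_; _⊎-dec_; _→-dec_; decidable-stable; toWitness; toWitnessFalse; fromWitness; does-⇔; ⌊_⌋)
open import Relation.Unary using (Decidable; _≐_)
open import Relation.Unary.Properties using (≐-sym; ≐-trans)

open Equivalence using (to; from)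

-- Write k = ω − 1. In a claw-free graph a neighbour x of v has a clique Ext v x of at most k
-- neighbours outside N[v]. If deg_{G²}(v) ≥ 2ω(ω−1) − 3 ("v is heavy"), double counting the pairs
-- (x , a) with x ∈ N(v) and a ∈ Ext v x shows that every x ∈ N(v) has a private neighbour: one
-- adjacent to no other vertex of N(v). By claw-freeness N(v) is then a disjoint union of two
-- cliques of size k with no edges between them. If (ii) fails, every v has a neighbour x = σ v
-- such that v is heavy or deg_{G²}(x) ≥ 2ω(ω−1) − 2, and v lies in the two cliques
-- {v} ∪ (N(v) ∩ N[x]) and {v} ∪ (N(v) ∖ N[x]), which meet only in v. Any two adjacent vertices
-- have such a clique in common, so these cliques form a Krausz partition of the edges, that is,
-- they are the vertices of the root graph F.

private
  variable
    n m : ℕ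

-- Counting with indicator functions

𝟙 : ∀ {A : Set} → Dec A → ℕ
𝟙 d = if does d then 1 else 0

card : {P : Fin n → Set} → Decidable P → ℕ
card P? = sum (λ i → 𝟙 (P? i))

𝟙-yes : ∀ {A : Set} (d : Dec A) → A → 𝟙 d ≡ 1
𝟙-yes (yes _) _ = refl
𝟙-yes (no ¬a) a = contradiction a ¬a

𝟙-no : ∀ {A : Set} (d : Dec A) → ¬ A → 𝟙 d ≡ 0
𝟙-no (yes a) ¬a = contradiction a ¬a
𝟙-no (no _)  _  = refl

𝟙-mono : ∀ {A B : Set} (a : Dec A) (b : Dec B) → (A → B) → 𝟙 a ≤ 𝟙 b
𝟙-mono (yes a) b f = ≤-reflexive (sym (𝟙-yes b (f a)))
𝟙-mono (no _)  b f = z≤n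

𝟙-≤ : ∀ {A : Set} (a : Dec A) {c} → (A → 1 ≤ c) → 𝟙 a ≤ c
𝟙-≤ (yes a) f = f a
𝟙-≤ (no _)  f = z≤n

𝟙-× : ∀ {A B : Set} (a : Dec A) (b : Dec B) → 𝟙 (a ×-dec b) ≡ 𝟙 a * 𝟙 b
𝟙-× (yes _) b = sym (+-identityʳ _)
𝟙-× (no _)  b = refl

sum-mono : {f g : Fin n → ℕ} → (∀ i → f i ≤ g i) → sum f ≤ sum g
sum-mono {zero}  h = z≤n
sum-mono {suc n} h = +-mono-≤ (h zero) (sum-mono (h ∘ suc))

sum-at : ∀ (j : Fin n) c → sum (λ i → 𝟙 (j ≟ i) * c) ≡ c
sum-at {suc n} zero c = trans (cong₂ _+_ (*-identityˡ c) (sum-replicate-zero n)) (+-identityʳ c)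
sum-at {suc n} (suc j) c = trans (sum-cong-≗ pointwise) (sum-at j c)
  where
  pointwise : ∀ i → 𝟙 (suc j ≟ suc i) * c ≡ 𝟙 (j ≟ i) * c
  pointwise i with j ≟ i
  ... | yes refl = refl
  ... | no _     = refl

card-mono : {P Q : Fin n → Set} (P? : Decidable P) (Q? : Decidable Q) →
  (∀ i → P i → Q i) → card P? ≤ card Q?
card-mono P? Q? h = sum-mono (λ i → 𝟙-mono (P? i) (Q? i) (h i))

card-≟ : (j : Fin n) → card (j ≟_) ≡ 1
card-≟ j = trans (sum-cong-≗ (λ i → sym (*-identityʳ (𝟙 (j ≟ i))))) (sum-at j 1)

card-⊎-≤ : {P Q : Fin n → Set} (P? : Decidable P) (Q? : Decidable Q) →
  card (λ i → P? i ⊎-dec Q? i) ≤ card P? + card Q?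
card-⊎-≤ P? Q? = ≤-trans (sum-mono pointwise) (≤-reflexive (∑-distrib-+ (𝟙 ∘ P?) (𝟙 ∘ Q?)))
  where
  pointwise : ∀ i → 𝟙 (P? i ⊎-dec Q? i) ≤ 𝟙 (P? i) + 𝟙 (Q? i)
  pointwise i with P? i
  ... | yes _ = s≤s z≤n
  ... | no _  = ≤-refl

card-⊎-≥ : {P Q : Fin n → Set} (P? : Decidable P) (Q? : Decidable Q) →
  (∀ i → P i → ¬ Q i) → card P? + card Q? ≤ card (λ i → P? i ⊎-dec Q? i)
card-⊎-≥ P? Q? h = ≤-trans (≤-reflexive (sym (∑-distrib-+ (𝟙 ∘ P?) (𝟙 ∘ Q?)))) (sum-mono pointwise)
  where
  pointwise : ∀ i → 𝟙 (P? i) + 𝟙 (Q? i) ≤ 𝟙 (P? i ⊎-dec Q? i)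
  pointwise i with P? i
  ... | yes p = ≤-reflexive (cong suc (𝟙-no (Q? i) (h i p)))
  ... | no _  = ≤-refl

card-∋ : {P : Fin n → Set} (P? : Decidable P) {x : Fin n} → P x → 1 ≤ card P?
card-∋ P? {x} px =
  ≤-trans (≤-reflexive (sym (card-≟ x))) (card-mono (x ≟_) P? (λ { _ refl → px }))

card-∋∋ : {P : Fin n → Set} (P? : Decidable P) {x y : Fin n} → P x → P y → x ≢ y → 2 ≤ card P?
card-∋∋ P? {x} {y} px py x≢y =
  ≤-trans (≤-reflexive (sym (cong₂ _+_ (card-≟ x) (card-≟ y))))
 (≤-trans (card-⊎-≥ (x ≟_) (y ≟_) (λ { _ refl y≡x → x≢y (sym y≡x) }))
          (card-mono (λ i → (x ≟ i) ⊎-dec (y ≟ i)) P? (λ { _ (inj₁ refl) → px ; _ (inj₂ refl) → py })))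

card-≤1 : {P : Fin n → Set} (P? : Decidable P) → (∀ i j → P i → P j → i ≡ j) → card P? ≤ 1
card-≤1 {n} P? h with any? P?
... | yes (i , pi) =
  ≤-trans (card-mono P? (i ≟_) (λ j → h i j pi)) (≤-reflexive (card-≟ i))
... | no ¬p =
  ≤-trans (sum-mono (λ i → ≤-reflexive (𝟙-no (P? i) (λ pi → ¬p (i , pi)))))
          (≤-trans (≤-reflexive (sum-replicate-zero n)) z≤n)

weighted-≤ : {Q : Fin n → Set} (Q? : Decidable Q) {f : Fin n → ℕ} {c : ℕ} →
  (∀ x → Q x → f x ≤ c) → sum (λ x → 𝟙 (Q? x) * f x) ≤ card Q? * c
weighted-≤ Q? {f} {c} h =
  ≤-trans (sum-mono pointwise) (≤-reflexive (sym (*-distribʳ-sum c (λ x → 𝟙 (Q? x)))))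
  where
  pointwise : ∀ x → 𝟙 (Q? x) * f x ≤ 𝟙 (Q? x) * c
  pointwise x with Q? x
  ... | yes q = +-monoˡ-≤ 0 (h x q)
  ... | no _  = z≤n

-- Count the pairs `(x , a)` with `Q x` and `R x a`: each `a` in `P` occurs at least `c` times, and
-- exchanging the two sums groups the pairs by `x` instead.
double-count : {P : Fin n → Set} {Q : Fin m → Set} {R : Fin m → Fin n → Set}
  (P? : Decidable P) (Q? : Decidable Q) (R? : ∀ x → Decidable (R x)) (c : ℕ) →
  (∀ a → P a → c ≤ card (λ x → Q? x ×-dec R? x a)) →
  c * card P? ≤ sum (λ x → 𝟙 (Q? x) * card (R? x))
double-count P? Q? R? c h = begin
  c * card P?                                         ≡⟨ *-distribˡ-sum c (𝟙 ∘ P?) ⟩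
  sum (λ a → c * 𝟙 (P? a))                            ≤⟨ sum-mono pointwise ⟩
  sum (λ a → sum (λ x → 𝟙 (Q? x) * 𝟙 (R? x a)))       ≡⟨ ∑-comm (λ a x → 𝟙 (Q? x) * 𝟙 (R? x a)) ⟩
  sum (λ x → sum (λ a → 𝟙 (Q? x) * 𝟙 (R? x a)))       ≡⟨ sum-cong-≗ (λ x → sym (*-distribˡ-sum (𝟙 (Q? x)) (𝟙 ∘ R? x))) ⟩
  sum (λ x → 𝟙 (Q? x) * card (R? x))                  ∎
  where
  open ≤-Reasoning
  pointwise : ∀ a → c * 𝟙 (P? a) ≤ sum (λ x → 𝟙 (Q? x) * 𝟙 (R? x a))
  pointwise a with P? a
  ... | yes p = ≤-trans (≤-reflexive (*-identityʳ c))
               (≤-trans (h a p) (≤-reflexive (sum-cong-≗ (λ x → 𝟙-× (Q? x) (R? x a)))))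
  ... | no _  = ≤-trans (≤-reflexive (*-zeroʳ c)) z≤n

union-bound : {P : Fin n → Set} {Q : Fin m → Set} {R : Fin m → Fin n → Set}
  (P? : Decidable P) (Q? : Decidable Q) (R? : ∀ x → Decidable (R x)) →
  (∀ a → P a → ∃[ x ] (Q x × R x a)) →
  card P? ≤ sum (λ x → 𝟙 (Q? x) * card (R? x))
union-bound P? Q? R? h = ≤-trans (≤-reflexive (sym (*-identityˡ _)))
  (double-count P? Q? R? 1 (λ a p → card-∋ (λ x → Q? x ×-dec R? x a) (proj₂ (h a p))))

∣tabulate∣ : (f : Fin n → Bool) → ∣ tabulate f ∣ ≡ card (λ i → T? (f i))
∣tabulate∣ {zero}  f = refl
∣tabulate∣ {suc n} f with f zero
... | true  = cong suc (∣tabulate∣ (f ∘ suc))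
... | false = ∣tabulate∣ (f ∘ suc)

-- The clique number bounds bit vectors in `Subset n`; this carries the bound over to decidable
-- predicates, the form in which cliques are counted below.
clique-card : {G : Graph n} {ω : ℕ} → (∀ S → IsClique G S → ∣ S ∣ ≤ ω) →
  {P : Fin n → Set} (P? : Decidable P) →
  (∀ u v → P u → P v → u ≢ v → Adj G u v) → card P? ≤ ω
clique-card {n} {G} bound {P} P? h =
  ≤-trans (≤-reflexive (trans (card-cong) (sym (∣tabulate∣ f))))
          (bound (tabulate f) (λ u v u∈ v∈ → h u v (member u∈) (member v∈)))
  where
  f : Fin n → Bool
  f i = ⌊ P? i ⌋
  card-cong : card P? ≡ card (λ i → T? (f i))
  card-cong = ≤-antisym (card-mono P? (T? ∘ f) (λ i → fromWitness))
                        (card-mono (T? ∘ f) P? (λ i → toWitness))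
  member : ∀ {u} → u ∈ₛ tabulate f → P u
  member {u} u∈ = toWitness (from T-≡ (trans (sym (lookup∘tabulate f u)) ([]=⇒lookup u∈)))

-- Subsets of Fin n coded as elements of Fin (2 ^ n)

bit : Bool → Fin 2
bit true  = suc zero
bit false = zero

bit-injective : ∀ {a b} → bit a ≡ bit b → a ≡ b
bit-injective {true}  {true}  _ = refl
bit-injective {false} {false} _ = refl

funToFin-cong : {f g : Fin n → Fin m} → (∀ i → f i ≡ g i) → funToFin f ≡ funToFin g
funToFin-cong {zero}  h = refl
funToFin-cong {suc n} h = cong₂ combine (h zero) (funToFin-cong (h ∘ suc))

-- The root graph needs its vertices in some `Fin m`. A clique is named by its characteristic
-- vector, so equal sets give the same vertex; numbers that code no chosen clique become isolated
-- vertices.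
code : {P : Fin n → Set} → Decidable P → Fin (2 ^ n)
code P? = funToFin (λ i → bit (does (P? i)))

does-⇒ : ∀ {A B : Set} (a : Dec A) (b : Dec B) → does a ≡ does b → A → B
does-⇒ a       (yes b) _  _ = b
does-⇒ (no ¬a) (no _)  _  a = contradiction a ¬a

code-cong : {P Q : Fin n → Set} (P? : Decidable P) (Q? : Decidable Q) → P ≐ Q → code P? ≡ code Q?
code-cong P? Q? (P⊆Q , Q⊆P) = funToFin-cong (λ i → cong bit (does-⇔ (mk⇔ P⊆Q Q⊆P) (P? i) (Q? i)))

code-injective : {P Q : Fin n → Set} (P? : Decidable P) (Q? : Decidable Q) → code P? ≡ code Q? → P ≐ Q
code-injective P? Q? eq =
  (λ {i} → does-⇒ (P? i) (Q? i) (bits i)) , (λ {i} → does-⇒ (Q? i) (P? i) (sym (bits i)))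
  where
  bits : ∀ i → does (P? i) ≡ does (Q? i)
  bits i = bit-injective (trans (sym (finToFun-funToFin _ i))
          (trans (cong (λ c → finToFun c i) eq) (finToFun-funToFin _ i)))

-- Graphs whose vertices are labelled by pairs of endpoints

Edge-≡ : {H : Graph m} {a b a' b' : Fin m} {lt : a F.< b} {lt' : a' F.< b'}
  {ad : Adj H a b} {ad' : Adj H a' b'} →
  a ≡ a' → b ≡ b' → _≡_ {A = Edge H} (a , b , lt , ad) (a' , b' , lt' , ad')
Edge-≡ {a = a} {b = b} refl refl =
  cong₂ (λ l t → a , b , l , t) (F.<-irrelevant _ _) (T-irrelevant _ _)

same-or-not : ∀ i j → i ≡ j ⊎ i ≡ not j
same-or-not true  true  = inj₁ refl
same-or-not true  false = inj₂ refl
same-or-not false true  = inj₂ refl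
same-or-not false false = inj₁ refl

-- Krausz's criterion, with each vertex `v` of `G` turned into the edge between `end v true` and
-- `end v false`: the hypotheses exclude loops and parallel edges and identify adjacency with having
-- a common endpoint.
module Endpoints
  {n m : ℕ} (G : Graph n) (end : Fin n → Bool → Fin m)
  (loopless : ∀ v → end v true ≢ end v false)
  (simple : ∀ u v i j → end u i ≡ end v j → end u (not i) ≡ end v (not j) → u ≡ v)
  (share⇒adj : ∀ u v i j → end u i ≡ end v j → u ≢ v → Adj G u v)
  (adj⇒share : ∀ u v → Adj G u v → ∃₂ λ i j → end u i ≡ end v j)
  where

  loopless' : ∀ v i → end v i ≢ end v (not i)
  loopless' v true  = loopless v
  loopless' v false = loopless v ∘ sym

  Joins : Fin m → Fin m → Fin n → Set
  Joins a b v = (end v true ≡ a × end v false ≡ b) ⊎ (end v false ≡ a × end v true ≡ b)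

  Joins? : ∀ a b → Decidable (Joins a b)
  Joins? a b v = ((end v true ≟ a) ×-dec (end v false ≟ b)) ⊎-dec ((end v false ≟ a) ×-dec (end v true ≟ b))

  joins : ∀ v i → Joins (end v i) (end v (not i)) v
  joins v true  = inj₁ (refl , refl)
  joins v false = inj₂ (refl , refl)

  joins-swap : ∀ {a b v} → Joins a b v → Joins b a v
  joins-swap (inj₁ (p , q)) = inj₂ (q , p)
  joins-swap (inj₂ (p , q)) = inj₁ (q , p)

  joins-side : ∀ {a b v} → Joins a b v → ∃[ i ] (end v i ≡ a × end v (not i) ≡ b)
  joins-side (inj₁ pq) = true , pq
  joins-side (inj₂ pq) = false , pq

  root : Graph m
  root = record
    { adj     = λ a b → ⌊ any? (Joins? a b) ⌋
    ; adj-sym = symmetric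
    ; adj-irr = irreflexive
    }
    where
    symmetric : ∀ a b → ⌊ any? (Joins? a b) ⌋ ≡ ⌊ any? (Joins? b a) ⌋
    symmetric a b with any? (Joins? a b) | any? (Joins? b a)
    ... | yes _       | yes _       = refl
    ... | no _        | no _        = refl
    ... | yes (v , j) | no ¬p       = contradiction (v , joins-swap j) ¬p
    ... | no ¬p       | yes (v , j) = contradiction (v , joins-swap j) ¬p
    irreflexive : ∀ a → ⌊ any? (Joins? a a) ⌋ ≡ false
    irreflexive a with any? (Joins? a a)
    ... | no _ = refl
    ... | yes (v , inj₁ (p , q)) = contradiction (trans p (sym q)) (loopless v)
    ... | yes (v , inj₂ (p , q)) = contradiction (trans q (sym p)) (loopless v)

  -- `Edge` stores its smaller endpoint first, so a side of `v` has to be singled out before `v` can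
  -- be read as an edge.
  orient : ∀ v → ∃[ i ] (end v i F.< end v (not i))
  orient v with F.<-cmp (end v true) (end v false)
  ... | tri< lt _ _ = true , lt
  ... | tri≈ _ eq _ = contradiction eq (loopless v)
  ... | tri> _ _ gt = false , gt

  edge : Fin n → Edge root
  edge v = end v (proj₁ (orient v)) , end v (not (proj₁ (orient v))) , proj₂ (orient v) ,
           fromWitness (v , joins v _)

  edge-injective : ∀ u v → edge u ≡ edge v → u ≡ v
  edge-injective u v eq =
    simple u v _ _ (cong proj₁ eq) (cong (λ e → proj₁ (proj₂ e)) eq)

  edge-surjective : ∀ e → ∃[ u ] edge u ≡ e
  edge-surjective (a , b , a<b , ad) with toWitness ad
  ... | v , j with joins-side j
  ... | i , refl , refl with orient v in eq
  ... | o , lt with same-or-not i o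
  ... | inj₁ refl = v , Edge-≡ {H = root}
          (cong (end v ∘ proj₁) eq)
          (cong (end v ∘ not ∘ proj₁) eq)
  -- The side `i` is opposite to the one chosen by `orient`, so the same edge would be ordered both
  -- ways.
  ... | inj₂ refl = contradiction
          (subst (λ o' → end v (not o) F.< end v o') (not-involutive o) a<b)
          (F.<-asym lt)

  isLineGraph : IsLineGraphOf G root
  isLineGraph = edge , edge-injective , edge-surjective , λ u v → forth u v , back u v
    where
    forth : ∀ u v → Adj G u v → LAdj root (edge u) (edge v)
    forth u v uv = (λ eq → apart (edge-injective u v eq)) , meet
      where
      apart : u ≢ v
      apart refl = subst T (adj-irr G u) uv
      meet : _
      meet with adj⇒share u v uv
      ... | i , j , eq with same-or-not i (proj₁ (orient u)) | same-or-not j (proj₁ (orient v))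
      ... | inj₁ refl | inj₁ refl = inj₁ eq
      ... | inj₁ refl | inj₂ refl = inj₂ (inj₁ eq)
      ... | inj₂ refl | inj₁ refl = inj₂ (inj₂ (inj₁ eq))
      ... | inj₂ refl | inj₂ refl = inj₂ (inj₂ (inj₂ eq))
    back : ∀ u v → LAdj root (edge u) (edge v) → Adj G u v
    back u v (ne , meet) = share meet
      where
      u≢v : u ≢ v
      u≢v refl = ne refl
      share : _ → Adj G u v
      share (inj₁ eq)               = share⇒adj u v _ _ eq u≢v
      share (inj₂ (inj₁ eq))        = share⇒adj u v _ _ eq u≢v
      share (inj₂ (inj₂ (inj₁ eq))) = share⇒adj u v _ _ eq u≢v
      share (inj₂ (inj₂ (inj₂ eq))) = share⇒adj u v _ _ eq u≢v

  EndsAt : Fin m → Fin n → Set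
  EndsAt a v = ∃[ i ] end v i ≡ a

  EndsAt? : ∀ a → Decidable (EndsAt a)
  EndsAt? a v with end v true ≟ a | end v false ≟ a
  ... | yes p | _     = yes (true , p)
  ... | no _  | yes q = yes (false , q)
  ... | no ¬p | no ¬q = no λ { (true , p) → ¬p p ; (false , q) → ¬q q }

  -- `Joins a b v` matches neighbours `b` of `a` with vertices `v` that end at `a`. Matches are
  -- unique: `loopless` fixes `b` given `v`, and `simple` fixes `v` given `b`. A union bound in each
  -- direction gives equality.
  degree-root : ∀ a → degree root a ≡ card (EndsAt? a)
  degree-root a = trans (∣tabulate∣ (adj root a)) (≤-antisym upper lower)
    where
    adjacent? : Decidable (Adj root a)
    adjacent? b = T? _
    upper : card adjacent? ≤ card (EndsAt? a)
    upper = ≤-trans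
      (union-bound adjacent? (EndsAt? a) (λ v b → Joins? a b v) cover)
      (≤-trans (weighted-≤ (EndsAt? a) (λ v _ → card-≤1 (λ b → Joins? a b v) (unique v)))
               (≤-reflexive (*-identityʳ _)))
      where
      cover : ∀ b → Adj root a b → ∃[ v ] (EndsAt a v × Joins a b v)
      cover b ab with toWitness ab
      ... | v , j with joins-side j
      ... | i , eq , _ = v , (i , eq) , j
      unique : ∀ v b c → Joins a b v → Joins a c v → b ≡ c
      unique v b c j k with joins-side j | joins-side k
      ... | i , refl , refl | i' , q , refl with same-or-not i' i
      ... | inj₁ refl = refl
      ... | inj₂ refl = contradiction (sym q) (loopless' v i)
    lower : card (EndsAt? a) ≤ card adjacent?
    lower = ≤-trans
      (union-bound (EndsAt? a) adjacent? (λ b → Joins? a b) cover)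
      (≤-trans (weighted-≤ adjacent? (λ b _ → card-≤1 (Joins? a b) (unique b)))
               (≤-reflexive (*-identityʳ _)))
      where
      cover : ∀ v → EndsAt a v → ∃[ b ] (Adj root a b × Joins a b v)
      cover v (i , refl) = end v (not i) , fromWitness (v , joins v i) , joins v i
      unique : ∀ b u v → Joins a b u → Joins a b v → u ≡ v
      unique b u v j k with joins-side j | joins-side k
      ... | i , p , q | i' , p' , q' = simple u v i i' (trans p (sym p')) (trans q (sym q'))

-- The numerical contradictions, with d = deg v and s the number of vertices at distance two from v

sparse-contra : ∀ {k d s} → 4 ≤ k → d ≤ 3 * k → 2 * s ≤ d * k → 2 * suc k * k ≤ d + s + 3 → ⊥
sparse-contra {d = d} {s} 4≤k d≤ s≤ D≤ with m≤n⇒∃[o]m+o≡n 4≤k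
-- With k = 4 + j the gap has natural coefficients: 4k(k+1) exceeds 3k(k+2) + 6 by k² - 2k - 6 = j²
-- + 6j + 2.
... | j , refl = m+1+n≰m (3 * (4 + j) * (6 + j) + 6) {j * j + 6 * j + 1} (begin
  3 * (4 + j) * (6 + j) + 6 + suc (j * j + 6 * j + 1) ≡⟨ expand j ⟩
  2 * (2 * suc (4 + j) * (4 + j))                     ≤⟨ *-monoʳ-≤ 2 D≤ ⟩
  2 * (d + s + 3)                                     ≡⟨ split d s ⟩
  2 * s + (2 * d + 6)                                 ≤⟨ +-monoˡ-≤ (2 * d + 6) s≤ ⟩
  d * (4 + j) + (2 * d + 6)                           ≡⟨ collect d j ⟩
  d * (6 + j) + 6                                     ≤⟨ +-monoˡ-≤ 6 (*-monoˡ-≤ (6 + j) d≤) ⟩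
  3 * (4 + j) * (6 + j) + 6                           ∎)
  where
  open ≤-Reasoning
  expand : ∀ j → 3 * (4 + j) * (6 + j) + 6 + suc (j * j + 6 * j + 1) ≡ 2 * (2 * suc (4 + j) * (4 + j))
  expand = solve-∀
  split : ∀ d s → 2 * (d + s + 3) ≡ 2 * s + (2 * d + 6)
  split = solve-∀
  collect : ∀ d j → d * (4 + j) + (2 * d + 6) ≡ d * (6 + j) + 6
  collect = solve-∀

dense-contra : ∀ {k d s} → 4 ≤ k → d ≤ k * suc k → s ≤ 3 * k → 2 * suc k * k ≤ d + s + 3 → ⊥
dense-contra {d = d} {s} 4≤k d≤ s≤ D≤ with m≤n⇒∃[o]m+o≡n 4≤k
-- Here 2k(k+1) exceeds k(k+1) + 3k + 3 by k² - 2k - 3 = j² + 6j + 5.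
... | j , refl = m+1+n≰m ((4 + j) * suc (4 + j) + 3 * (4 + j) + 3) {j * j + 6 * j + 4} (begin
  (4 + j) * suc (4 + j) + 3 * (4 + j) + 3 + suc (j * j + 6 * j + 4) ≡⟨ expand j ⟩
  2 * suc (4 + j) * (4 + j)                                         ≤⟨ D≤ ⟩
  d + s + 3                                                         ≤⟨ +-monoˡ-≤ 3 (+-mono-≤ d≤ s≤) ⟩
  (4 + j) * suc (4 + j) + 3 * (4 + j) + 3                           ∎)
  where
  open ≤-Reasoning
  expand : ∀ j → (4 + j) * suc (4 + j) + 3 * (4 + j) + 3 + suc (j * j + 6 * j + 4) ≡ 2 * suc (4 + j) * (4 + j)
  expand = solve-∀

-- Multiplying d + 1 ≤ 2k by k + 1 puts d + dk + k below 2k(k+1), which is at most d + dk + 3; so k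
-- would be at most 3.
small-degree-contra : ∀ {k d s} → 4 ≤ k → d < 2 * k → s ≤ d * k → 2 * suc k * k ≤ d + s + 3 → ⊥
small-degree-contra {k} {d} {s} 4≤k d< s≤ D≤ = <⇒≱ 4≤k (+-cancelˡ-≤ (d + d * k) k 3 (begin
  d + d * k + k           ≤⟨ n≤1+n _ ⟩
  suc (d + d * k + k)     ≡⟨ expand d k ⟩
  suc d * suc k           ≤⟨ *-monoˡ-≤ (suc k) d< ⟩
  2 * k * suc k           ≡⟨ reorder k ⟩
  2 * suc k * k           ≤⟨ D≤ ⟩
  d + s + 3               ≤⟨ +-monoˡ-≤ 3 (+-monoʳ-≤ d s≤) ⟩
  d + d * k + 3           ∎))
  where
  open ≤-Reasoning
  expand : ∀ d k → suc (d + d * k + k) ≡ suc d * suc k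
  expand = solve-∀
  reorder : ∀ k → 2 * k * suc k ≡ 2 * suc k * k
  reorder = solve-∀

-- If s falls short of dk by y + k - x, then d + s falls short of 2k(k+1) by at least as much, since
-- d(k+1) ≤ 2k(k+1). A deficit of at most c bounds this shortfall by c.
excess : ∀ {k d s x y c} → d ≤ 2 * k → s + y + k ≤ d * k + x → 2 * suc k * k ≤ d + s + c → y + k ≤ x + c
excess {k} {d} {s} {x} {y} {c} d≤ s≤ D≤ = +-cancelˡ-≤ (2 * suc k * k) (y + k) (x + c) (begin
  2 * suc k * k + (y + k) ≤⟨ +-monoˡ-≤ (y + k) D≤ ⟩
  d + s + c + (y + k)     ≡⟨ shuffle d s c y k ⟩
  s + y + k + (d + c)     ≤⟨ +-monoˡ-≤ (d + c) s≤ ⟩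
  d * k + x + (d + c)     ≡⟨ collect d k x c ⟩
  d * suc k + (x + c)     ≤⟨ +-monoˡ-≤ (x + c) (*-monoˡ-≤ (suc k) d≤) ⟩
  2 * k * suc k + (x + c) ≡⟨ cong (_+ (x + c)) (reorder k) ⟩
  2 * suc k * k + (x + c) ∎)
  where
  open ≤-Reasoning
  shuffle : ∀ d s c y k → d + s + c + (y + k) ≡ s + y + k + (d + c)
  shuffle = solve-∀
  collect : ∀ d k x c → d * k + x + (d + c) ≡ d * suc k + (x + c)
  collect = solve-∀
  reorder : ∀ k → 2 * k * suc k ≡ 2 * suc k * k
  reorder = solve-∀

-- Neighbourhoods in claw-free graphs

module ClawFreeNeighbourhoods
  {n : ℕ} (G : Graph n) (claw-free : ClawFree G)
  (k : ℕ) (4≤k : 4 ≤ k) (ω-bound : ∀ S → IsClique G S → ∣ S ∣ ≤ suc k)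
  where

  infix 4 _~_ _~?_

  _~_ : Fin n → Fin n → Set
  u ~ v = Adj G u v

  _~?_ : ∀ u v → Dec (u ~ v)
  u ~? v = T? (adj G u v)

  ~-sym : ∀ {u v} → u ~ v → v ~ u
  ~-sym {u} {v} = subst T (adj-sym G u v)

  ~⇒≢ : ∀ {u v} → u ~ v → u ≢ v
  ~⇒≢ {u} uu refl = subst T (adj-irr G u) uu

  no-claw : ∀ {c a b d} → c ~ a → c ~ b → c ~ d → a ≢ b → a ≢ d → b ≢ d →
    ¬ a ~ b → ¬ a ~ d → b ~ d
  no-claw {b = b} {d} ca cb cd a≢b a≢d b≢d ¬ab ¬ad =
    decidable-stable (b ~? d) (claw-free _ _ _ _ ca cb cd a≢b a≢d b≢d ¬ab ¬ad)

  -- Cliques given by predicates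

  IsCliqueᵖ : (Fin n → Set) → Set
  IsCliqueᵖ P = ∀ u v → P u → P v → u ≢ v → u ~ v

  clique≤ : {P : Fin n → Set} (P? : Decidable P) → IsCliqueᵖ P → card P? ≤ suc k
  clique≤ = clique-card {G = G} ω-bound

  -- Adding `x` leaves a clique, and a clique has at most k + 1 vertices.
  dominated-clique≤ : {P : Fin n → Set} (P? : Decidable P) → IsCliqueᵖ P →
    (x : Fin n) → (∀ y → P y → x ~ y) → card P? ≤ k
  dominated-clique≤ {P} P? cl x h = s≤s⁻¹ (begin
    suc (card P?)                        ≡⟨ cong (_+ card P?) (sym (card-≟ x)) ⟩
    card (x ≟_) + card P?                ≤⟨ card-⊎-≥ (x ≟_) P? (λ { _ refl px → ~⇒≢ (h x px) refl }) ⟩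
    card (λ y → (x ≟ y) ⊎-dec P? y)      ≤⟨ clique≤ (λ y → (x ≟ y) ⊎-dec P? y) extended ⟩
    suc k                                ∎)
    where
    open ≤-Reasoning
    extended : IsCliqueᵖ (λ y → x ≡ y ⊎ P y)
    extended u v (inj₁ refl) (inj₁ refl) ne = contradiction refl ne
    extended u v (inj₁ refl) (inj₂ pv)   ne = h v pv
    extended u v (inj₂ pu)   (inj₁ refl) ne = ~-sym (h u pu)
    extended u v (inj₂ pu)   (inj₂ pv)   ne = cl u v pu pv ne

  -- A greedy pass over all vertices. A vertex of `P` is rejected only because of a non-neighbour
  -- already chosen, and that witness survives because `K` only grows.
  maximal-clique : {P : Fin n → Set} → Decidable P →
    Σ[ K ∈ (Fin n → Set) ] (Decidable K × (∀ x → K x → P x) × IsCliqueᵖ K ×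
      (∀ y → P y → K y ⊎ ∃[ x ] (K x × x ≢ y × ¬ x ~ y)))
  maximal-clique {P} P? with greedy (allFin n)
    where
    greedy : (L : List (Fin n)) →
      Σ[ K ∈ (Fin n → Set) ] (Decidable K × (∀ x → K x → P x) × IsCliqueᵖ K ×
        (∀ y → y ∈ L → P y → K y ⊎ ∃[ x ] (K x × x ≢ y × ¬ x ~ y)))
    greedy [] = (λ _ → ⊥) , (λ _ → no id) , (λ _ ()) , (λ _ _ ()) , (λ _ ())
    greedy (z ∷ L) with greedy L
    ... | K , K? , K⊆P , clique , maximal
      with P? z | any? (λ x → K? x ×-dec (¬? (x ≟ z) ×-dec ¬? (x ~? z)))
    ... | no ¬pz | _ = K , K? , K⊆P , clique ,
      λ { y (here refl) py → contradiction py ¬pz ; y (there y∈) py → maximal y y∈ py }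
    ... | yes pz | yes (x , q) = K , K? , K⊆P , clique ,
      λ { y (here refl) py → inj₂ (x , q) ; y (there y∈) py → maximal y y∈ py }
    ... | yes pz | no ¬q =
      (λ y → z ≡ y ⊎ K y) , (λ y → (z ≟ y) ⊎-dec K? y) ,
      (λ { _ (inj₁ refl) → pz ; x (inj₂ kx) → K⊆P x kx }) ,
      clique' , maximal'
      where
      adjacent : ∀ x → K x → x ≢ z → x ~ z
      adjacent x kx ne = decidable-stable (x ~? z) (λ ¬xz → ¬q (x , kx , ne , ¬xz))
      clique' : IsCliqueᵖ (λ y → z ≡ y ⊎ K y)
      clique' u v (inj₁ refl) (inj₁ refl) ne = contradiction refl ne
      clique' u v (inj₁ refl) (inj₂ kv)   ne = ~-sym (adjacent v kv (ne ∘ sym))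
      clique' u v (inj₂ ku)   (inj₁ refl) ne = adjacent u ku ne
      clique' u v (inj₂ ku)   (inj₂ kv)   ne = clique u v ku kv ne
      maximal' : ∀ y → y ∈ z ∷ L → P y →
        (z ≡ y ⊎ K y) ⊎ ∃[ x ] ((z ≡ x ⊎ K x) × x ≢ y × ¬ x ~ y)
      maximal' y (here refl) py = inj₁ (inj₁ refl)
      maximal' y (there y∈)  py with maximal y y∈ py
      ... | inj₁ ky              = inj₁ (inj₂ ky)
      ... | inj₂ (x , kx , rest) = inj₂ (x , inj₂ kx , rest)
  ... | K , K? , K⊆P , clique , maximal =
    K , K? , K⊆P , clique , (λ y → maximal y (∈-allFin y))

  -- Used in both directions: for `x` in N(v), `Ext v x` is the contribution of `x` to the second
  -- neighbourhood of `v`, while `Ext x v` is the part of N(v) missed by `x`.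
  Ext : Fin n → Fin n → Fin n → Set
  Ext v x a = x ~ a × a ≢ v × ¬ v ~ a

  Ext? : ∀ v x → Decidable (Ext v x)
  Ext? v x a = (x ~? a) ×-dec (¬? (a ≟ v) ×-dec ¬? (v ~? a))

  -- Otherwise `v`, `a` and `b` would be the leaves of a claw centred at `x`.
  ext-clique : ∀ {v x} → v ~ x → IsCliqueᵖ (Ext v x)
  ext-clique vx a b (xa , a≢v , ¬va) (xb , b≢v , ¬vb) a≢b =
    no-claw (~-sym vx) xa xb (a≢v ∘ sym) (b≢v ∘ sym) a≢b ¬va ¬vb

  ext≤ : ∀ {v x} → v ~ x → card (Ext? v x) ≤ k
  ext≤ {v} {x} vx = dominated-clique≤ (Ext? v x) (ext-clique vx) x (λ _ → proj₁)

  -- Degrees and second neighbourhoods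

  deg : Fin n → ℕ
  deg v = card (v ~?_)

  Second : Fin n → Fin n → Set
  Second v a = ∃[ x ] (v ~ x × Ext v x a)

  Second? : ∀ v → Decidable (Second v)
  Second? v a = any? (λ x → (v ~? x) ×-dec Ext? v x a)

  deg₂ : Fin n → ℕ
  deg₂ v = card (Second? v)

  degSq≤ : ∀ v → degSq G v ≤ deg v + deg₂ v
  degSq≤ v = begin
    degSq G v                                ≡⟨ ∣tabulate∣ (sqAdj G v) ⟩
    card (T? ∘ sqAdj G v)                    ≤⟨ card-mono (T? ∘ sqAdj G v) (λ a → (v ~? a) ⊎-dec Second? v a) split ⟩
    card (λ a → (v ~? a) ⊎-dec Second? v a)  ≤⟨ card-⊎-≤ (v ~?_) (Second? v) ⟩
    deg v + deg₂ v                           ∎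
    where
    open ≤-Reasoning
    split : ∀ a → T (sqAdj G v a) → v ~ a ⊎ Second v a
    split a h with v ~? a
    ... | yes va = inj₁ va
    ... | no ¬va with to T-∧ h
    ... | h₁ , h₂ with to T-∨ h₂
    ... | inj₁ va = inj₁ va
    ... | inj₂ h₃ with toWitness {a? = any? (λ w → T? _)} h₃
    ... | x , h₄ with to T-∧ h₄
    ... | vx , xa = inj₂ (x , vx , xa , toWitnessFalse {a? = v ≟ a} h₁ ∘ sym , ¬va)

  deg₂≤ : ∀ v → deg₂ v ≤ deg v * k
  deg₂≤ v = ≤-trans (union-bound (Second? v) (v ~?_) (Ext? v) (λ _ → id))
                    (weighted-≤ (v ~?_) (λ x → ext≤))

  -- A maximal clique `K` in N(v) has at most k vertices, and every vertex of N(v) outside `K` is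
  -- missed by some `x` in `K`. Each such `x` accounts for itself and at most k missed vertices.
  deg≤ : ∀ v → deg v ≤ k * suc k
  deg≤ v with maximal-clique (v ~?_)
  ... | K , K? , K⊆N , clique , maximal = begin
    deg v                                                            ≤⟨ union-bound (v ~?_) K? near? cover ⟩
    sum (λ x → 𝟙 (K? x) * card (near? x))                            ≤⟨ weighted-≤ K? near≤ ⟩
    card K? * suc k                                                  ≤⟨ *-monoˡ-≤ (suc k) (dominated-clique≤ K? clique v K⊆N) ⟩
    k * suc k                                                        ∎
    where
    open ≤-Reasoning
    near? : ∀ x → Decidable (λ y → x ≡ y ⊎ Ext x v y)
    near? x y = (x ≟ y) ⊎-dec Ext? x v y
    near≤ : ∀ x → K x → card (near? x) ≤ suc k
    near≤ x kx = ≤-trans (card-⊎-≤ (x ≟_) (Ext? x v))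
                (≤-trans (≤-reflexive (cong (_+ card (Ext? x v)) (card-≟ x)))
                         (s≤s (ext≤ (~-sym (K⊆N x kx)))))
    cover : ∀ y → v ~ y → ∃[ x ] (K x × (x ≡ y ⊎ Ext x v y))
    cover y vy with maximal y vy
    ... | inj₁ ky                    = y , ky , inj₁ refl
    ... | inj₂ (x , kx , x≢y , ¬xy) = x , kx , inj₂ (vy , x≢y ∘ sym , ¬xy)

  Private : Fin n → Fin n → Fin n → Set
  Private v x a = Ext v x a × (∀ y → v ~ y → y ~ a → y ≡ x)

  Private? : ∀ v x → Decidable (Private v x)
  Private? v x a = Ext? v x a ×-dec all? (λ y → (v ~? y) →-dec ((y ~? a) →-dec (y ≟ x)))

  shared : ∀ {v x a} → Ext v x a → ¬ Private v x a → ∃[ y ] (v ~ y × y ≢ x × Ext v y a)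
  shared {v} {x} {a} e@(_ , a≢v , ¬va) ¬priv
    with any? (λ y → (v ~? y) ×-dec ((y ~? a) ×-dec ¬? (y ≟ x)))
  ... | yes (y , vy , ya , y≢x) = y , vy , y≢x , ya , a≢v , ¬va
  ... | no ¬y = contradiction
    (e , λ y vy ya → decidable-stable (y ≟ x) (λ y≢x → ¬y (y , vy , ya , y≢x))) ¬priv

  -- Two non-adjacent common neighbours of `v` and `x` would form a claw at `x` with `a`, since the
  -- private neighbour `a` is adjacent to neither.
  common-clique : ∀ {v x a} → Private v x a → IsCliqueᵖ (λ y → v ~ y × x ~ y)
  common-clique {v} {x} {a} ((xa , _ , ¬va) , only) y z (vy , xy) (vz , xz) y≢z =
    no-claw xa xy xz (a≢ vy) (a≢ vz) y≢z (¬a~ vy xy) (¬a~ vz xz)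
    where
    a≢ : ∀ {y} → v ~ y → a ≢ y
    a≢ vy refl = ¬va vy
    ¬a~ : ∀ {y} → v ~ y → x ~ y → ¬ a ~ y
    ¬a~ vy xy ay = ~⇒≢ xy (sym (only _ vy (~-sym ay)))

  -- c is the allowed deficit from 2ω(ω−1), where ω = k + 1.
  Heavy : ℕ → Fin n → Set
  Heavy c v = 2 * suc k * k ≤ degSq G v + c

  heavy-sum : ∀ {c v} → Heavy c v → 2 * suc k * k ≤ deg v + deg₂ v + c
  heavy-sum {c} {v} h = ≤-trans h (+-monoˡ-≤ c (degSq≤ v))

  heavy-weaken : ∀ {v} → Heavy 2 v → Heavy 3 v
  heavy-weaken {v} h = ≤-trans h (+-monoʳ-≤ (degSq G v) (n≤1+n 2))

  Near : Fin n → Fin n → Fin n → Set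
  Near v x y = v ~ y × (y ≡ x ⊎ x ~ y)

  Near? : ∀ v x → Decidable (Near v x)
  Near? v x y = (v ~? y) ×-dec ((y ≟ x) ⊎-dec (x ~? y))

  near-or-ext : ∀ {v y} x → v ~ y → Near v x y ⊎ Ext x v y
  near-or-ext {v} {y} x vy with y ≟ x | x ~? y
  ... | yes y≡x | _      = inj₁ (vy , inj₁ y≡x)
  ... | no _    | yes xy = inj₁ (vy , inj₂ xy)
  ... | no y≢x  | no ¬xy = inj₂ (vy , y≢x , ¬xy)

  deg≤near+ext : ∀ v x → deg v ≤ card (Near? v x) + card (Ext? x v)
  deg≤near+ext v x = ≤-trans
    (card-mono (v ~?_) (λ y → Near? v x y ⊎-dec Ext? x v y) (λ y → near-or-ext x))
    (card-⊎-≤ (Near? v x) (Ext? x v))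

  -- For a at distance two from v and x a common neighbour, the vertices of N(v) missed by a
  -- split into two cliques: those adjacent to x and those not adjacent to x.
  deg≤common : ∀ {v a} → Second v a → deg v ≤ 2 * k + card (λ x → (v ~? x) ×-dec Ext? v x a)
  deg≤common {v} {a} (x , vx , xa , a≢v , ¬va) = begin
    deg v                                                  ≤⟨ card-mono (v ~?_) (λ y → (missed? y ⊎-dec Ext? x v y) ⊎-dec common? y) cover ⟩
    card (λ y → (missed? y ⊎-dec Ext? x v y) ⊎-dec common? y) ≤⟨ card-⊎-≤ (λ y → missed? y ⊎-dec Ext? x v y) common? ⟩
    card (λ y → missed? y ⊎-dec Ext? x v y) + card common? ≤⟨ +-monoˡ-≤ (card common?) (card-⊎-≤ missed? (Ext? x v)) ⟩
    card missed? + card (Ext? x v) + card common?          ≤⟨ +-monoˡ-≤ (card common?) (+-mono-≤ missed≤ (ext≤ (~-sym vx))) ⟩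
    k + k + card common?                                   ≡⟨ cong (λ l → k + l + card common?) (sym (+-identityʳ k)) ⟩
    2 * k + card common?                                   ∎
    where
    open ≤-Reasoning
    common? : Decidable (λ y → v ~ y × Ext v y a)
    common? y = (v ~? y) ×-dec Ext? v y a
    missed? : Decidable (λ y → v ~ y × x ~ y × ¬ y ~ a)
    missed? y = (v ~? y) ×-dec ((x ~? y) ×-dec ¬? (y ~? a))
    missed≤ : card missed? ≤ k
    missed≤ = dominated-clique≤ missed?
      (λ { y z (vy , xy , ¬ya) (vz , xz , ¬za) y≢z →
        no-claw xa xy xz (λ { refl → ¬va vy }) (λ { refl → ¬va vz }) y≢z (¬ya ∘ ~-sym) (¬za ∘ ~-sym) })
      v (λ _ → proj₁)
    cover : ∀ y → v ~ y → ((v ~ y × x ~ y × ¬ y ~ a) ⊎ Ext x v y) ⊎ (v ~ y × Ext v y a)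
    cover y vy with y ~? a | near-or-ext x vy
    ... | yes ya | _                       = inj₂ (vy , ya , a≢v , ¬va)
    ... | no _   | inj₂ e                  = inj₁ (inj₂ e)
    ... | no ¬ya | inj₁ (_ , inj₁ refl)    = contradiction xa ¬ya
    ... | no ¬ya | inj₁ (_ , inj₂ xy)      = inj₁ (inj₁ (vy , xy , ¬ya))

  -- The neighbourhood of a heavy vertex

  multiplicity-bound : ∀ v c → (∀ a → Second v a → c ≤ card (λ x → (v ~? x) ×-dec Ext? v x a)) →
    c * deg₂ v ≤ deg v * k
  multiplicity-bound v c h = ≤-trans
    (double-count (Second? v) (v ~?_) (Ext? v) c h) (weighted-≤ (v ~?_) (λ x → ext≤))

  -- With no private neighbours, every vertex at distance two is reached at least twice. This halves
  -- the bound on `deg₂ v`, which suffices if deg v ≤ 3k. For larger degree, `deg≤common` forces so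
  -- high a multiplicity that `deg₂ v` is at most 3k.
  heavy⇒some-private : ∀ {v} → Heavy 3 v → ∃₂ λ x a → v ~ x × Private v x a
  heavy⇒some-private {v} heavy with any? (λ x → (v ~? x) ×-dec any? (Private? v x))
  ... | yes (x , vx , a , priv) = x , a , vx , priv
  ... | no none = ⊥-elim contra
    where
    twice : ∀ a → Second v a → 2 ≤ card (λ x → (v ~? x) ×-dec Ext? v x a)
    twice a (x , vx , e) with shared e (λ priv → none (x , vx , a , priv))
    ... | y , vy , y≢x , e' = card-∋∋ (λ x → (v ~? x) ×-dec Ext? v x a) (vy , e') (vx , e) y≢x
    contra : ⊥
    contra with deg v ≤? 3 * k
    ... | yes d≤ = sparse-contra 4≤k d≤ (multiplicity-bound v 2 twice) (heavy-sum heavy)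
    ... | no d≰ = dense-contra 4≤k (deg≤ v) deg₂≤3k (heavy-sum heavy)
      where
      -- By `deg≤common` each vertex at distance two is reached at least r times, and k < r gives r
      -- · deg₂ v ≤ (2k + r)k ≤ 3rk.
      r = deg v ∸ 2 * k
      d≡ : 2 * k + r ≡ deg v
      d≡ = m+[n∸m]≡n (≤-trans (*-monoˡ-≤ k (n≤1+n 2)) (<⇒≤ (≰⇒> d≰)))
      k<r : k < r
      k<r = +-cancelˡ-< (2 * k) k r
        (subst₂ _<_ (+-comm k (2 * k)) (sym d≡) (≰⇒> d≰))
      instance
        r≢0 : NonZero r
        r≢0 = >-nonZero (≤-<-trans z≤n k<r)
      open ≤-Reasoning
      deg₂≤3k : deg₂ v ≤ 3 * k
      deg₂≤3k = *-cancelˡ-≤ r (begin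
        r * deg₂ v     ≤⟨ multiplicity-bound v r (λ a s → m≤n+o⇒m∸n≤o (deg v) (2 * k) (deg≤common s)) ⟩
        deg v * k      ≡⟨ cong (_* k) (sym d≡) ⟩
        (2 * k + r) * k ≤⟨ *-monoˡ-≤ k (+-monoˡ-≤ r (*-monoʳ-≤ 2 (<⇒≤ k<r))) ⟩
        (2 * r + r) * k ≡⟨ collect r k ⟩
        r * (3 * k)    ∎)
        where
        collect : ∀ r k → (2 * r + r) * k ≡ r * (3 * k)
        collect = solve-∀

  -- Let `x` have a private neighbour. The part of N(v) in N[x] is then a clique by `common-clique`,
  -- and the part missed by `x` is always one; each has at most k vertices.
  heavy⇒deg≤ : ∀ {v} → Heavy 3 v → deg v ≤ 2 * k
  heavy⇒deg≤ {v} heavy with heavy⇒some-private heavy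
  ... | x , a , vx , priv = ≤-trans (deg≤near+ext v x)
    (≤-trans (+-mono-≤ near≤ (ext≤ (~-sym vx))) (≤-reflexive (cong (k +_) (sym (+-identityʳ k)))))
    where
    near-clique : IsCliqueᵖ (Near v x)
    near-clique y z (_ , inj₁ refl) (_ , inj₁ refl)  y≢z = contradiction refl y≢z
    near-clique y z (_ , inj₁ refl) (_ , inj₂ xz)    y≢z = xz
    near-clique y z (_ , inj₂ xy)   (_ , inj₁ refl)  y≢z = ~-sym xy
    near-clique y z (vy , inj₂ xy)  (vz , inj₂ xz)   y≢z = common-clique priv y z (vy , xy) (vz , xz) y≢z
    near≤ : card (Near? v x) ≤ k
    near≤ = dominated-clique≤ (Near? v x) near-clique v (λ _ → proj₁)

  heavy⇒deg≥ : ∀ {v} → Heavy 3 v → 2 * k ≤ deg v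
  heavy⇒deg≥ {v} heavy = ≮⇒≥ (λ d< → small-degree-contra 4≤k d< (deg₂≤ v) (heavy-sum heavy))

  -- If `x` had no private neighbour, the other neighbours of `v` would already reach all of the
  -- second neighbourhood. That saves k in the bound `deg v * k`, whereas `excess` permits a saving
  -- of at most 3.
  heavy⇒private : ∀ {v x} → Heavy 3 v → v ~ x → ∃[ a ] Private v x a
  heavy⇒private {v} {x} heavy vx with any? (Private? v x)
  ... | yes priv = priv
  ... | no none = contradiction
    (excess {x = 0} {y = 0} {c = 3} (heavy⇒deg≤ heavy) few (heavy-sum heavy)) (<⇒≱ 4≤k)
    where
    others? : Decidable (λ y → v ~ y × y ≢ x)
    others? y = (v ~? y) ×-dec ¬? (y ≟ x)
    cover : ∀ a → Second v a → ∃[ y ] ((v ~ y × y ≢ x) × Ext v y a)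
    cover a (y , vy , e) with y ≟ x
    ... | no y≢x = y , (vy , y≢x) , e
    ... | yes refl with shared e (λ priv → none (a , priv))
    ... | z , vz , z≢x , e' = z , (vz , z≢x) , e'
    open ≤-Reasoning
    few : deg₂ v + 0 + k ≤ deg v * k + 0
    few = begin
      deg₂ v + 0 + k                   ≡⟨ cong (_+ k) (+-identityʳ (deg₂ v)) ⟩
      deg₂ v + k                       ≤⟨ +-monoˡ-≤ k (≤-trans
        (union-bound (Second? v) others? (Ext? v) cover)
        (weighted-≤ others? (λ y → ext≤ ∘ proj₁))) ⟩
      card others? * k + k             ≡⟨ +-comm (card others? * k) k ⟩
      (1 + card others?) * k           ≡⟨ cong (λ l → (l + card others?) * k) (sym (card-≟ x)) ⟩
      (card (x ≟_) + card others?) * k ≤⟨ *-monoˡ-≤ k (≤-trans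
        (card-⊎-≥ (x ≟_) others? (λ { _ refl (_ , ne) → ne refl }))
        (card-mono (λ y → (x ≟ y) ⊎-dec others? y) (v ~?_)
          (λ { _ (inj₁ refl) → vx ; _ (inj₂ (vy , _)) → vy }))) ⟩
      deg v * k                        ≡⟨ sym (+-identityʳ _) ⟩
      deg v * k + 0                    ∎

  -- Every neighbour of a heavy vertex has a private neighbour, so `common-clique` applies at each
  -- of them. Adjacency or equality is thus an equivalence relation on N(v), whose classes are
  -- cliques.
  heavy-trans : ∀ {v x y z} → Heavy 3 v → v ~ x → v ~ y → v ~ z → x ~ y → x ~ z → y ≢ z → y ~ z
  heavy-trans heavy vx vy vz xy xz =
    common-clique (proj₂ (heavy⇒private heavy vx)) _ _ (vy , xy) (vz , xz)

  -- The two cliques through a vertex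

  Line Coline : Fin n → Fin n → Fin n → Set
  Line   v x y = y ≡ v ⊎ Near v x y
  Coline v x y = y ≡ v ⊎ Ext x v y

  -- For adjacent `v` and `x` both sides are N[v] ∩ N[x].
  line-sym : ∀ {v x} → v ~ x → Line v x ≐ Line x v
  line-sym vx = swap vx , swap (~-sym vx)
    where
    swap : ∀ {v x} → v ~ x → ∀ {y} → Line v x y → Line x v y
    swap vx (inj₁ refl)             = inj₂ (~-sym vx , inj₁ refl)
    swap vx (inj₂ (vy , inj₁ refl)) = inj₁ refl
    swap vx (inj₂ (vy , inj₂ xy))   = inj₂ (xy , inj₂ vy)

  -- Adjacent `u` and `v` lie in the same clique component of N(w).
  line-eq : ∀ {w u v} → Heavy 3 w → w ~ u → w ~ v → u ~ v → Line w u ≐ Line w v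
  line-eq {w} heavy wu wv uv = sub wu wv uv , sub wv wu (~-sym uv)
    where
    sub : ∀ {u v} → w ~ u → w ~ v → u ~ v → ∀ {y} → Line w u y → Line w v y
    sub wu wv uv (inj₁ refl) = inj₁ refl
    sub wu wv uv (inj₂ (wy , inj₁ refl)) = inj₂ (wy , inj₂ (~-sym uv))
    sub {v = v} wu wv uv {y} (inj₂ (wy , inj₂ uy)) with y ≟ v
    ... | yes y≡v = inj₂ (wy , inj₁ y≡v)
    ... | no y≢v  = inj₂ (wy , inj₂ (heavy-trans heavy wu wv wy uv uy (y≢v ∘ sym)))

  -- As the line is symmetric in `v` and `x`, transitivity may be used in the neighbourhood of
  -- whichever of them is heavy.
  line-clique : ∀ {v x} → v ~ x → Heavy 3 v ⊎ Heavy 3 x → IsCliqueᵖ (Line v x)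
  line-clique {v} {x} vx heavy = clique
    where
    common : ∀ {y z} → v ~ y → x ~ y → v ~ z → x ~ z → y ≢ z → y ~ z
    common vy xy vz xz = [ (λ hv → heavy-trans hv vx vy vz xy xz)
                         , (λ hx → heavy-trans hx (~-sym vx) xy xz vy vz) ]′ heavy
    clique : IsCliqueᵖ (Line v x)
    clique y z (inj₁ refl) (inj₁ refl) ne = contradiction refl ne
    clique y z (inj₁ refl) (inj₂ (vz , _)) ne = vz
    clique y z (inj₂ (vy , _)) (inj₁ refl) ne = ~-sym vy
    clique y z (inj₂ (_ , inj₁ refl)) (inj₂ (_ , inj₁ refl)) ne = contradiction refl ne
    clique y z (inj₂ (_ , inj₁ refl)) (inj₂ (_ , inj₂ xz)) ne = xz
    clique y z (inj₂ (_ , inj₂ xy)) (inj₂ (_ , inj₁ refl)) ne = ~-sym xy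
    clique y z (inj₂ (vy , inj₂ xy)) (inj₂ (vz , inj₂ xz)) ne = common vy xy vz xz ne

  coline-clique : ∀ {v x} → v ~ x → IsCliqueᵖ (Coline v x)
  coline-clique vx y z (inj₁ refl) (inj₁ refl) ne = contradiction refl ne
  coline-clique vx y z (inj₁ refl) (inj₂ (vz , _)) ne = vz
  coline-clique vx y z (inj₂ (vy , _)) (inj₁ refl) ne = ~-sym vy
  coline-clique vx y z (inj₂ ey) (inj₂ ez) ne = ext-clique (~-sym vx) y z ey ez ne

  -- N(v) has only two possible components: that of `x`, and the clique of vertices missed by `x`.
  -- The line through `u` depends only on the component of `u`.
  line-at-heavy : ∀ {v x u} → Heavy 3 v → v ~ x → v ~ u → Line v u ≐ Line v x ⊎ Line v u ≐ Coline v x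
  line-at-heavy {v} {x} {u} heavy vx vu with near-or-ext x vu
  ... | inj₁ (_ , inj₁ refl) = inj₁ (id , id)
  ... | inj₁ (_ , inj₂ xu)   = inj₁ (line-eq heavy vu vx (~-sym xu))
  ... | inj₂ e@(_ , u≢x , ¬xu) = inj₂ (forth , back)
    where
    forth : ∀ {y} → Line v u y → Coline v x y
    forth (inj₁ refl) = inj₁ refl
    forth (inj₂ (vy , inj₁ refl)) = inj₂ e
    forth {y} (inj₂ (vy , inj₂ uy)) with near-or-ext x vy
    ... | inj₁ (_ , inj₁ refl) = contradiction (~-sym uy) ¬xu
    ... | inj₁ (_ , inj₂ xy)   = contradiction (heavy-trans heavy vy vx vu (~-sym xy) (~-sym uy) (u≢x ∘ sym)) ¬xu
    ... | inj₂ ey = inj₂ ey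
    back : ∀ {y} → Coline v x y → Line v u y
    back (inj₁ refl) = inj₁ refl
    back {y} (inj₂ ey) with y ≟ u
    ... | yes refl = inj₂ (vu , inj₁ refl)
    ... | no y≢u   = inj₂ (proj₁ ey , inj₂ (ext-clique (~-sym vx) u y e ey (y≢u ∘ sym)))

  -- Lets a heavy `v` share a clique with a neighbour `u` that has its own anchor `w`. If only `w`
  -- is known to be heavy, the clique is the line of `u` when `v` lies in N[w], and the coline of
  -- `u` when `w` misses `v`.
  line-near-heavy : ∀ {v u w} → Heavy 3 v → v ~ u → u ~ w → Heavy 3 u ⊎ Heavy 3 w →
    Line v u ≐ Line u w ⊎ Line v u ≐ Coline u w
  line-near-heavy hv vu uw (inj₁ hu) with line-at-heavy hu uw (~-sym vu)
  ... | inj₁ eq = inj₁ (≐-trans (line-sym vu) eq)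
  ... | inj₂ eq = inj₂ (≐-trans (line-sym vu) eq)
  line-near-heavy {v} {u} {w} hv vu uw (inj₂ hw) with near-or-ext w (~-sym vu)
  ... | inj₁ (_ , inj₁ refl) = inj₁ (line-sym vu)
  -- All lines in the triangle agree: pass from `u` to `w` inside N(v), then from `v` to `u` inside
  -- N(w).
  ... | inj₁ (_ , inj₂ wv)   = inj₁
    (≐-trans (line-eq hv vu (~-sym wv) uw)
    (≐-trans (line-sym (~-sym wv))
    (≐-trans (line-eq hw wv (~-sym uw) vu) (line-sym (~-sym uw)))))
  ... | inj₂ e@(uv , v≢w , ¬wv) = inj₂ (forth , back)
    where
    wu = ~-sym uw
    forth : ∀ {y} → Line v u y → Coline u w y
    forth (inj₁ refl) = inj₂ e
    forth (inj₂ (vy , inj₁ refl)) = inj₁ refl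
    forth {y} (inj₂ (vy , inj₂ uy)) with near-or-ext w uy
    ... | inj₂ ey = inj₂ ey
    ... | inj₁ (_ , inj₁ refl) = contradiction (~-sym vy) ¬wv
    -- y ∈ N(w) would be adjacent to the private neighbour a of u, since both lie in N(v) and are adjacent to u.
    ... | inj₁ (_ , inj₂ wy) with heavy⇒private hw wu
    ... | a , ea@(ua , a≢w , ¬wa) , only = contradiction (only y wy ya) (~⇒≢ uy ∘ sym)
      where
      v≢a : v ≢ a
      v≢a refl = ~⇒≢ uy (sym (only y wy (~-sym vy)))
      va : v ~ a
      va = ext-clique wu v a e ea v≢a
      ya : y ~ a
      ya = heavy-trans hv vu vy va uy ua (λ { refl → ¬wa wy })
    back : ∀ {y} → Coline u w y → Line v u y
    back (inj₁ refl) = inj₂ (vu , inj₁ refl)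
    back {y} (inj₂ ey) with y ≟ v
    ... | yes y≡v = inj₁ y≡v
    ... | no y≢v  = inj₂ (ext-clique wu v y e ey (y≢v ∘ sym) , inj₂ (proj₁ ey))

  -- Agreement of the colines of two adjacent vertices with heavy anchors

  Crossing : Fin n → Fin n → Fin n → Fin n → Set
  Crossing w v w' x = Ext w v x × w' ~ x

  Crossing? : ∀ w v w' → Decidable (Crossing w v w')
  Crossing? w v w' x = Ext? w v x ×-dec (w' ~? x)

  -- N²(w) is covered by the crossing vertices at v together with the sets Ext w y ∖ {u} over the
  -- other neighbours y of w; every y crossing at u has u in Ext w y, which saves one.
  crossing-bound : ∀ {w v w' u y₀} → Heavy 2 w → w ~ v → w' ~ u → Ext w v u → Ext w' u v →
    Crossing w' u w y₀ → y₀ ≢ v → card (Crossing? w' u w) + k ≤ card (Crossing? w v w') + 3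
  crossing-bound {w} {v} {w'} {u} {y₀} heavy wv w'u eu@(vu , u≢w , ¬wu) (uv , v≢w' , ¬w'v) (ey₀ , wy₀) y₀≢v =
    -- The 3 is the deficit 2 plus one for `v`, which itself crosses at `u`.
    ≤-trans (excess (heavy⇒deg≤ (heavy-weaken heavy)) total (heavy-sum heavy))
            (≤-reflexive (+-assoc (card X?) 1 2))
    where
    X? = Crossing? w v w'
    Y? = Crossing? w' u w
    E : Fin n → Fin n → Set
    E y a = (v ≡ y × Crossing w v w' a) ⊎ (v ≢ y × Ext w y a × a ≢ u)
    E? : ∀ y → Decidable (E y)
    E? y a = ((v ≟ y) ×-dec X? a) ⊎-dec (¬? (v ≟ y) ×-dec (Ext? w y a ×-dec ¬? (a ≟ u)))
    cover : ∀ a → Second w a → ∃[ y ] (w ~ y × E y a)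
    cover a (y , wy , ea@(ya , a≢w , ¬wa)) with v ≟ y | a ≟ u
    ... | no v≢y | no a≢u   = y , wy , inj₂ (v≢y , ea , a≢u)
    ... | no v≢y | yes refl = v , wv , inj₁ (refl , eu , w'u)
    ... | yes refl | yes refl = v , wv , inj₁ (refl , eu , w'u)
    ... | yes refl | no a≢u with w' ~? a
    ... | yes w'a = v , wv , inj₁ (refl , ea , w'a)
    -- Here `a` is adjacent to `u` and missed by `w'`, so it lies with `y₀` in the clique `Ext w' u`
    -- and is reached through `y₀`.
    ... | no ¬w'a = y₀ , wy₀ , inj₂ (y₀≢v ∘ sym , (y₀a , a≢w , ¬wa) , a≢u)
      where
      ua : u ~ a
      ua = ext-clique wv u a eu ea (a≢u ∘ sym)
      y₀a : y₀ ~ a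
      y₀a = ext-clique w'u y₀ a ey₀ (ua , (λ { refl → ¬w'v (~-sym ya) }) , ¬w'a) (λ { refl → ¬wa wy₀ })
    E-other≤ : ∀ y → w ~ y → v ≢ y → (q : Dec (Crossing w' u w y)) → card (E? y) + 𝟙 q ≤ k
    E-other≤ y wy v≢y (no _) = ≤-trans (≤-reflexive (+-identityʳ _)) (≤-trans
        (card-mono (E? y) (Ext? w y) (λ { a (inj₁ (v≡y , _)) → contradiction v≡y v≢y ; a (inj₂ (_ , ea , _)) → ea }))
        (ext≤ wy))
    E-other≤ y wy v≢y (yes ((uy , _) , _)) = begin
      card (E? y) + 1                     ≡⟨ cong (card (E? y) +_) (sym (card-≟ u)) ⟩
      card (E? y) + card (u ≟_)           ≤⟨ card-⊎-≥ (E? y) (u ≟_)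
        (λ { a (inj₁ (v≡y , _)) _ → v≢y v≡y ; a (inj₂ (_ , _ , a≢u)) u≡a → a≢u (sym u≡a) }) ⟩
      card (λ a → E? y a ⊎-dec (u ≟ a))   ≤⟨ card-mono (λ a → E? y a ⊎-dec (u ≟ a)) (Ext? w y)
                                              (λ { a (inj₁ (inj₁ (v≡y , _))) → contradiction v≡y v≢y
                                                 ; a (inj₁ (inj₂ (_ , ea , _))) → ea
                                                 ; a (inj₂ refl) → ~-sym uy , u≢w , ¬wu }) ⟩
      card (Ext? w y)                     ≤⟨ ext≤ wy ⟩
      k                                   ∎
      where open ≤-Reasoning
    -- Each neighbour `y` of `w` pays k, including one for a crossing at `u`. At y = v the terms in
    -- k cancel, leaving `card X?` and the one for the crossing of `v`.
    pointwise : ∀ y (p : Dec (w ~ y)) (q : Dec (v ≡ y)) →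
      𝟙 p * card (E? y) + 𝟙 (Y? y) + 𝟙 q * k ≤ 𝟙 p * k + 𝟙 q * (card X? + 1)
    pointwise y (no ¬wy) (yes refl) = contradiction wv ¬wy
    pointwise y (no ¬wy) (no _) = ≤-reflexive (trans (+-identityʳ _) (𝟙-no (Y? y) (¬wy ∘ proj₂)))
    pointwise y (yes wy) (no v≢y) = +-monoˡ-≤ 0
      (≤-trans (≤-reflexive (cong (_+ 𝟙 (Y? y)) (+-identityʳ (card (E? y)))))
      (≤-trans (E-other≤ y wy v≢y (Y? y)) (≤-reflexive (sym (+-identityʳ k)))))
    pointwise y (yes wy) (yes refl) = begin
      1 * card (E? v) + 𝟙 (Y? v) + 1 * k ≤⟨ +-monoˡ-≤ (1 * k) (+-mono-≤ (*-monoʳ-≤ 1 Ev≤) (𝟙-≤ (Y? v) (λ _ → ≤-refl))) ⟩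
      1 * card X? + 1 + 1 * k            ≡⟨ reorder (card X?) k ⟩
      1 * k + 1 * (card X? + 1)          ∎
      where
      open ≤-Reasoning
      Ev≤ : card (E? v) ≤ card X?
      Ev≤ = card-mono (E? v) X? (λ { a (inj₁ (_ , xa)) → xa ; a (inj₂ (v≢v , _)) → contradiction refl v≢v })
      reorder : ∀ x k → 1 * x + 1 + 1 * k ≡ 1 * k + 1 * (x + 1)
      reorder = solve-∀
    open ≤-Reasoning
    weight at-v at-Y : Fin n → ℕ
    weight y = 𝟙 (w ~? y) * card (E? y)
    at-Y y = 𝟙 (Y? y)
    at-v y = 𝟙 (v ≟ y) * k
    total : deg₂ w + card Y? + k ≤ deg w * k + (card X? + 1)
    total = begin
      deg₂ w + card Y? + k                 ≤⟨ +-monoˡ-≤ k (+-monoˡ-≤ (card Y?) (union-bound (Second? w) (w ~?_) E? cover)) ⟩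
      sum weight + sum at-Y + k            ≡⟨ cong₂ _+_ (sym (∑-distrib-+ weight at-Y)) (sym (sum-at v k)) ⟩
      sum (λ y → weight y + at-Y y) + sum at-v ≡⟨ sym (∑-distrib-+ (λ y → weight y + at-Y y) at-v) ⟩
      sum (λ y → weight y + at-Y y + at-v y) ≤⟨ sum-mono (λ y → pointwise y (w ~? y) (v ≟ y)) ⟩
      sum (λ y → 𝟙 (w ~? y) * k + 𝟙 (v ≟ y) * (card X? + 1))
        ≡⟨ ∑-distrib-+ (λ y → 𝟙 (w ~? y) * k) (λ y → 𝟙 (v ≟ y) * (card X? + 1)) ⟩
      sum (λ y → 𝟙 (w ~? y) * k) + sum (λ y → 𝟙 (v ≟ y) * (card X? + 1))
        ≡⟨ cong₂ _+_ (sym (*-distribʳ-sum k (λ y → 𝟙 (w ~? y)))) (sum-at v (card X? + 1)) ⟩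
      deg w * k + (card X? + 1)            ∎

  -- Let X and Y count the crossings at `v` and at `u`. A second crossing at `u` gives Y + k ≤ X +
  -- 3. If `v` has a crossing besides `u`, the symmetric bound also holds and forces k ≤ 3;
  -- otherwise X ≤ 1 ≤ Y, which forces it as well.
  no-crossing : ∀ {w v w' u y₀} → Heavy 2 w → Heavy 2 w' → w ~ v → w' ~ u →
    Ext w v u → Ext w' u v → Crossing w' u w y₀ → y₀ ≡ v
  no-crossing {w} {v} {w'} {u} {y₀} hw hw' wv w'u eu ev cy₀ =
    decidable-stable (y₀ ≟ v) (λ y₀≢v → contra (crossing-bound hw wv w'u eu ev cy₀ y₀≢v))
    where
    open ≤-Reasoning
    X = card (Crossing? w v w')
    Y = card (Crossing? w' u w)
    contra : ¬ (Y + k ≤ X + 3)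
    contra Y≤ with any? (λ x → Crossing? w v w' x ×-dec ¬? (x ≟ u))
    ... | yes (x , cx , x≢u) = <⇒≱ 4≤k (+-cancelˡ-≤ (Y + X) k 3 (begin
      Y + X + k       ≡⟨ +-assoc Y X k ⟩
      Y + (X + k)     ≤⟨ +-monoʳ-≤ Y (crossing-bound hw' w'u wv ev eu cx x≢u) ⟩
      Y + (Y + 3)     ≤⟨ +-monoʳ-≤ Y (≤-trans (+-monoʳ-≤ Y (<⇒≤ 4≤k)) Y≤) ⟩
      Y + (X + 3)     ≡⟨ +-assoc Y X 3 ⟨
      Y + X + 3       ∎))
    ... | no none = <⇒≱ 4≤k (s≤s⁻¹ (begin
      1 + k ≤⟨ +-monoˡ-≤ k (card-∋ (Crossing? w' u w) cy₀) ⟩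
      Y + k ≤⟨ Y≤ ⟩
      X + 3 ≤⟨ +-monoˡ-≤ 3 (≤-trans (card-mono (Crossing? w v w') (u ≟_) only-u) (≤-reflexive (card-≟ u))) ⟩
      4     ∎))
      where
      only-u : ∀ x → Crossing w v w' x → u ≡ x
      only-u x cx = sym (decidable-stable (x ≟ u) (λ x≢u → none (x , cx , x≢u)))

  -- A vertex of `Ext w v` other than `u` is adjacent to `u` by `ext-clique`, and `w'` misses it
  -- because it would otherwise be a second crossing.
  coline-eq : ∀ {w v w' u} → Heavy 2 w → Heavy 2 w' → w ~ v → w' ~ u →
    Ext w v u → Ext w' u v → Coline v w ≐ Coline u w'
  coline-eq hw hw' wv w'u eu ev = sub hw hw' wv w'u eu ev , sub hw' hw w'u wv ev eu
    where
    sub : ∀ {w v w' u} → Heavy 2 w → Heavy 2 w' → w ~ v → w' ~ u →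
      Ext w v u → Ext w' u v → ∀ {y} → Coline v w y → Coline u w' y
    sub hw hw' wv w'u eu ev (inj₁ refl) = inj₂ ev
    sub {w} {v} {w'} {u} hw hw' wv w'u eu ev {y} (inj₂ ey) with y ≟ u
    ... | yes y≡u = inj₁ y≡u
    ... | no y≢u  = inj₂
      ( ext-clique wv u y eu ey (y≢u ∘ sym)
      , (λ { refl → proj₂ (proj₂ ev) (~-sym (proj₁ ey)) })
      , (λ w'y → y≢u (no-crossing hw' hw w'u wv ev eu (ey , w'y))) )

  line∩coline : ∀ {v x y} → Line v x y → Coline v x y → y ≡ v
  line∩coline (inj₁ y≡v) _ = y≡v
  line∩coline (inj₂ _) (inj₁ y≡v) = y≡v
  line∩coline (inj₂ (_ , inj₁ y≡x)) (inj₂ (_ , y≢x , _)) = contradiction y≡x y≢x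
  line∩coline (inj₂ (_ , inj₂ xy))  (inj₂ (_ , _ , ¬xy)) = contradiction xy ¬xy

  -- The Krausz partition obtained from a choice of anchors

  module Anchored
    (σ : Fin n → Fin n) (v~σ : ∀ v → v ~ σ v) (σ-heavy : ∀ v → Heavy 3 v ⊎ Heavy 2 (σ v))
    where

    Side : Fin n → Bool → Fin n → Set
    Side v true  = Line v (σ v)
    Side v false = Coline v (σ v)

    Side? : ∀ v i → Decidable (Side v i)
    Side? v true  y = (y ≟ v) ⊎-dec Near? v (σ v) y
    Side? v false y = (y ≟ v) ⊎-dec Ext? (σ v) v y

    v∈side : ∀ v i → Side v i v
    v∈side v true  = inj₁ refl
    v∈side v false = inj₁ refl

    σ-heavy₃ : ∀ v → Heavy 3 v ⊎ Heavy 3 (σ v)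
    σ-heavy₃ v with σ-heavy v
    ... | inj₁ h = inj₁ h
    ... | inj₂ h = inj₂ (heavy-weaken h)

    side-clique : ∀ v i → IsCliqueᵖ (Side v i)
    side-clique v true  = line-clique (v~σ v) (σ-heavy₃ v)
    side-clique v false = coline-clique (v~σ v)

    side-meet : ∀ v i {y} → Side v i y → Side v (not i) y → y ≡ v
    side-meet v true  p q = line∩coline p q
    side-meet v false p q = line∩coline q p

    at-heavy : ∀ {u v} → Heavy 3 v → v ~ u → ∃[ i ] Line v u ≐ Side v i
    at-heavy {v = v} hv vu with line-at-heavy hv (v~σ v) vu
    ... | inj₁ eq = true , eq
    ... | inj₂ eq = false , eq

    near-heavy : ∀ {u v} → Heavy 3 v → v ~ u → ∃[ i ] Line v u ≐ Side u i
    near-heavy {u} hv vu with line-near-heavy hv vu (v~σ u) (σ-heavy₃ u)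
    ... | inj₁ eq = true , eq
    ... | inj₂ eq = false , eq

    -- The common clique is `Line v u`, which is a side of `v` by `at-heavy` and a side of `u` by
    -- `near-heavy`.
    share-heavy : ∀ {u v} → Heavy 3 v → u ~ v → ∃₂ λ i j → Side u i ≐ Side v j
    share-heavy hv uv with near-heavy hv (~-sym uv) | at-heavy hv (~-sym uv)
    ... | i , p | j , q = i , j , ≐-trans (≐-sym p) q

    -- If `v` is not the anchor of `u`, both lie in one component of the anchor's neighbourhood, and
    -- the line of `u` is the line joining the anchor to `v`.
    share-anchor : ∀ {u v} → Heavy 2 (σ u) → u ~ v → Near u (σ u) v → ∃₂ λ i j → Side u i ≐ Side v j
    share-anchor hw uv (_ , inj₁ refl) = share-heavy (heavy-weaken hw) uv
    share-anchor {u} hw uv (_ , inj₂ wv) with near-heavy (heavy-weaken hw) wv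
    ... | j , p = true , j , ≐-trans (line-sym (v~σ u))
                            (≐-trans (line-eq (heavy-weaken hw) (~-sym (v~σ u)) wv uv) p)

    share-swap : ∀ {u v} → (∃₂ λ i j → Side u i ≐ Side v j) → ∃₂ λ i j → Side v i ≐ Side u j
    share-swap (i , j , p) = j , i , ≐-sym p

    share : ∀ {u v} → u ~ v → ∃₂ λ i j → Side u i ≐ Side v j
    share {u} {v} uv with σ-heavy u | σ-heavy v
    ... | _ | inj₁ hv = share-heavy hv uv
    ... | inj₁ hu | inj₂ _ = share-swap (share-heavy hu (~-sym uv))
    ... | inj₂ hw | inj₂ hw' with near-or-ext (σ u) uv | near-or-ext (σ v) (~-sym uv)
    ... | inj₁ near | _         = share-anchor hw uv near
    ... | inj₂ _    | inj₁ near = share-swap (share-anchor hw' (~-sym uv) near)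
    -- Each of `u` and `v` is missed by the other's anchor, so the two colines coincide.
    ... | inj₂ ev   | inj₂ eu   =
      false , false , coline-eq hw hw' (~-sym (v~σ u)) (~-sym (v~σ v)) ev eu

    end : Fin n → Bool → Fin (2 ^ n)
    end v i = code (Side? v i)

    end-∈ : ∀ u v i j → end u i ≡ end v j → Side v j u
    end-∈ u v i j eq = proj₁ (code-injective (Side? u i) (Side? v j) eq) (v∈side u i)

    -- The anchor lies on the line; on the coline as well, it would have to be `v` itself.
    loopless : ∀ v → end v true ≢ end v false
    loopless v eq = ~⇒≢ (v~σ v) (sym (side-meet v true σ∈ (proj₁ (code-injective (Side? v true) (Side? v false) eq) σ∈)))
      where
      σ∈ : Side v true (σ v)
      σ∈ = inj₂ (v~σ v , inj₁ refl)

    share⇒adj : ∀ u v i j → end u i ≡ end v j → u ≢ v → u ~ v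
    share⇒adj u v i j eq = side-clique v j u v (end-∈ u v i j eq) (v∈side v j)

    -- If both pairs of sides agree, `u` lies in both sides of `v`, which meet only in `v`.
    simple : ∀ u v i j → end u i ≡ end v j → end u (not i) ≡ end v (not j) → u ≡ v
    simple u v i j p q = side-meet v j (end-∈ u v i j p) (end-∈ u v (not i) (not j) q)

    adj⇒share : ∀ u v → u ~ v → ∃₂ λ i j → end u i ≡ end v j
    adj⇒share u v uv with share uv
    ... | i , j , eq = i , j , code-cong (Side? u i) (Side? v j) eq

    open Endpoints G end loopless simple share⇒adj adj⇒share

    -- The vertices of `G` that end at `a` are pairwise adjacent, so they form a clique.
    degree-root≤ : ∀ a → degree root a ≤ suc k
    degree-root≤ a = ≤-trans (≤-reflexive (degree-root a)) (clique≤ (EndsAt? a)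
      (λ { u v (i , p) (j , q) → share⇒adj u v i j (trans p (sym q)) }))

    -- A heavy vertex has at least 2k neighbours, of which its anchor misses at most k.
    line-size : ∀ {v} → Heavy 3 v → suc k ≤ card (Side? v true)
    line-size {v} hv = ≤-trans
      (+-mono-≤ (≤-reflexive (sym (card-≟ v))) k≤near)
      (≤-trans (card-⊎-≥ (v ≟_) (Near? v x) (λ { _ refl (vv , _) → ~⇒≢ vv refl }))
               (card-mono (λ y → (v ≟ y) ⊎-dec Near? v x y) (Side? v true)
                 (λ { _ (inj₁ refl) → inj₁ refl ; _ (inj₂ near) → inj₂ near })))
      where
      open ≤-Reasoning
      x = σ v
      k≤near : k ≤ card (Near? v x)
      k≤near = +-cancelʳ-≤ k k (card (Near? v x)) (begin
        k + k                              ≡⟨ cong (k +_) (sym (+-identityʳ k)) ⟩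
        2 * k                              ≤⟨ heavy⇒deg≥ hv ⟩
        deg v                              ≤⟨ deg≤near+ext v x ⟩
        card (Near? v x) + card (Ext? x v) ≤⟨ +-monoʳ-≤ (card (Near? v x)) (ext≤ (~-sym (v~σ v))) ⟩
        card (Near? v x) + k               ∎)

    -- Every vertex on the line of a heavy `v` has this line as one of its own sides, so the line
    -- size is a lower bound for the degree.
    degree-at-heavy : ∀ {v} → Heavy 3 v → degree root (end v true) ≡ suc k
    degree-at-heavy {v} hv = ≤-antisym (degree-root≤ (end v true))
      (≤-trans (line-size hv)
      (≤-trans (card-mono (Side? v true) (EndsAt? (end v true)) ends)
               (≤-reflexive (sym (degree-root (end v true))))))
      where
      ends : ∀ u → Side v true u → EndsAt (end v true) u
      ends u (inj₁ refl) = true , refl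
      ends u (inj₂ (vu , near)) with near-heavy hv vu
      ... | i , p = i , code-cong (Side? u i) (Side? v true) (≐-trans (≐-sym p) (same near))
        where
        same : u ≡ σ v ⊎ σ v ~ u → Line v u ≐ Line v (σ v)
        same (inj₁ refl) = id , id
        same (inj₂ xu)   = line-eq hv vu (v~σ v) (~-sym xu)

    line-graph : Fin n → Σ[ m ∈ ℕ ] Σ[ F ∈ Graph m ] (MaxDegree F (suc k) × IsLineGraphOf G F)
    line-graph v = 2 ^ n , root , (degree-root≤ , attained) , isLineGraph
      where
      attained : ∃[ a ] degree root a ≡ suc k
      attained with σ-heavy v
      ... | inj₁ h = end v true , degree-at-heavy h
      ... | inj₂ h = end (σ v) true , degree-at-heavy (heavy-weaken h)

-- From the failure of the degree alternative to anchors

vertex : ∀ {ω} (S : Subset n) → ∣ S ∣ ≡ suc ω → Fin n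
vertex (_ ∷ _) _ = zero

-- Turns a violated degree bound with truncated subtraction into `Heavy b`; strictness lowers the
-- deficit from `suc b` to `b`.
∸<⇒≤+ : ∀ a b {c} → a ∸ suc b < c → a ≤ c + b
∸<⇒≤+ a b {c} lt = begin
  a                     ≤⟨ m≤n+m∸n a (suc b) ⟩
  suc b + (a ∸ suc b)   ≡⟨ +-comm (suc b) (a ∸ suc b) ⟩
  a ∸ suc b + suc b     ≡⟨ +-suc (a ∸ suc b) b ⟩
  suc (a ∸ suc b) + b   ≤⟨ +-monoˡ-≤ b lt ⟩
  c + b                 ∎
  where open ≤-Reasoning

theorem6p4 : ∀ {n} (G : Graph n) (ω : ℕ) →
    Connected G → ClawFree G → CliqueNumber G ω → 5 ≤ ω →
    (Σ[ m ∈ ℕ ] Σ[ F ∈ Graph m ] (MaxDegree F ω × IsLineGraphOf G F))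
    ⊎ (∃[ v ] (degSq G v ≤ 2 * ω * (ω ∸ 1) ∸ 4
    × (∀ x → Adj G v x → degSq G x ≤ 2 * ω * (ω ∸ 1) ∸ 3)))
theorem6p4 {n} G (suc k) _ claw-free ((S , _ , S≡ω) , ω-bound) (s≤s 4≤k)
  with any? (λ v → (degSq G v ≤? D ∸ 4) ×-dec all? (λ x → T? (adj G v x) →-dec (degSq G x ≤? D ∸ 3)))
  where
  D = 2 * suc k * k
... | yes light = inj₂ light
... | no none = inj₁
  (Anchored.line-graph (proj₁ ∘ anchor) (proj₁ ∘ proj₂ ∘ anchor) (proj₂ ∘ proj₂ ∘ anchor) (vertex S S≡ω))
  where
  open ClawFreeNeighbourhoods G claw-free k 4≤k ω-bound
  D = 2 * suc k * k
  anchor : ∀ v → ∃[ x ] (v ~ x × (Heavy 3 v ⊎ Heavy 2 x))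
  anchor v with degSq G v ≤? D ∸ 4
  ... | no d≰ = x , vx , inj₁ heavy
    where
    heavy : Heavy 3 v
    heavy = ∸<⇒≤+ D 3 (≰⇒> d≰)
    -- Any neighbour can anchor a heavy vertex; this lemma supplies one.
    x = proj₁ (heavy⇒some-private heavy)
    vx = proj₁ (proj₂ (proj₂ (heavy⇒some-private heavy)))
  ... | yes d≤ with any? (λ x → (v ~? x) ×-dec ¬? (degSq G x ≤? D ∸ 3))
  ... | yes (x , vx , d≰) = x , vx , inj₂ (∸<⇒≤+ D 2 (≰⇒> d≰))
  ... | no all-light = contradiction
    (v , d≤ , λ x vx → decidable-stable (degSq G x ≤? D ∸ 3) (λ d≰ → all-light (x , vx , d≰))) none
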